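{- For all positive integers $n,m$, the second player wins the Peaceable Rooks Game $\mathrm{PR}(n,m)$ if and only if both $n$ and $m$ are even.
   Context: The Peaceable Rooks Game $\mathrm{PR}(n,m)$ is played on an $n\times m$ chessboard with squares $(x,y)$, $0\leq x\leq n-1$, $0\leq y\leq m-1$. Two players alternately place a rook on an unoccupied square; the first player places white rooks and the second player places black rooks. A player may not place a rook on a square within attacking range of a rook previously placed by the opponent. A player unable to move on their turn loses. Two distinct squares $(x_1,y_1)$ and $(x_2,y_2)$ are within attacking range for rooks iff $x_1=x_2$ or $y_1=y_2$ (regardless of any pieces standing between them). A player "wins" the game if that player has a winning strategy. -}

module Defs where

open import Data.Fin.Base using (Fin)
open import Data.List.Base using (List; []; _∷_)
open import Data.List.Membership.Propositional using (_∈_)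
open import Data.Nat.Base using (ℕ)
open import Data.Product.Base using (_×_; _,_; proj₁; proj₂)
open import Data.Sum.Base using (_⊎_)
open import Relation.Binary.PropositionalEquality.Core using (_≡_; _≢_)
open import Relation.Nullary.Negation.Core using (¬_)

data Player : Set where
  white black : Player

opponent : Player → Player
opponent white = black
opponent black = white

Square : ℕ → ℕ → Set
Square n m = Fin n × Fin m

-- The rooks on the board with their colours, most recently placed first.
Position : ℕ → ℕ → Set
Position n m = List (Player × Square n m)

module _ {n m : ℕ} where

  InRange : Square n m → Square n m → Set
  InRange s t = s ≢ t × (proj₁ s ≡ proj₁ t ⊎ proj₂ s ≡ proj₂ t)

  record Legal (p : Player) (s : Square n m) (pos : Position n m) : Set where
    field
      unoccupied : ∀ q → ¬ ((q , s) ∈ pos)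
      unattacked : ∀ t → (opponent p , t) ∈ pos → ¬ InRange t s

  -- An element of WinsToMove p pos (resp. WinsToWait p pos) is a winning
  -- strategy for p from pos, with p (resp. p's opponent) to move: it prescribes
  -- a legal move at each turn of p, and a continuation for every legal move of
  -- the opponent.  A player with no legal move loses: WinsToMove p pos is then
  -- empty, and WinsToWait p pos holds vacuously when the opponent is stuck.
  -- Being inductive, a strategy also guarantees that p wins after finitely
  -- many moves.
  data WinsToMove (p : Player) (pos : Position n m) : Set
  data WinsToWait (p : Player) (pos : Position n m) : Set

  data WinsToMove p pos where
    play : ∀ s → Legal p s pos → WinsToWait p ((p , s) ∷ pos) →
           WinsToMove p pos

  data WinsToWait p pos where
    respond : (∀ s → Legal (opponent p) s pos →
               WinsToMove p ((opponent p , s) ∷ pos)) →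
              WinsToWait p pos

-- White is the first player, black the second.
SecondPlayerWins : ℕ → ℕ → Set
SecondPlayerWins n m = WinsToWait {n} {m} black []

{-# OPTIONS --safe #-}
-- The player to wait answers every rook by its image under the rotation of the
-- board by 180°.  This works as soon as no square left to the opponent shares a
-- row or a column with its own image.  Only the middle row and the middle
-- column contain squares failing that, and they exist only for odd dimensions:
-- if both dimensions are even, Black can follow the strategy from the start,
-- and otherwise White first occupies a square that takes every middle line away
-- from Black and follows it from then on.
module Submission where

open import Defs
open import Data.Empty using (⊥; ⊥-elim)
open import Data.Fin.Base using (Fin; toℕ; fromℕ<; opposite; combine)
open import Data.Fin.Properties as Fin
  using (toℕ<n; toℕ-injective; toℕ-fromℕ<; opposite-prop; opposite-involutive; combine-injective)
open import Data.Fin.Subset using (Subset; _⊂_; _-_; ⊤) renaming (_∈_ to _∈ˢ_)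
open import Data.Fin.Subset.Induction using (⊂-wellFounded)
open import Data.Fin.Subset.Properties using (∈⊤; x∈p∧x≢y⇒x∈p-y; x∈p⇒p-x⊂p)
open import Data.List.Base using ([]; _∷_)
open import Data.List.Membership.Propositional using (_∈_)
open import Data.List.Relation.Unary.Any using (here; there)
open import Data.Nat.Base using (ℕ; suc; _+_; _*_; _∸_; NonZero; s≤s; z≤n)
open import Data.Nat.Divisibility using (_∣_; _∣?_; n∣m*n; m%n≡0⇒n∣m; n∣m⇒m%n≡0)
open import Data.Nat.DivMod
  using (_/_; _%_; m%n<n; m/n<m; m*n/n≡m; m≡m%n+[m/n]*n; [m+kn]%n≡m%n; +-distrib-/-∣ʳ)
open import Data.Nat.Properties using (*-comm; +-identityʳ; m+n∸m≡n; m+[n∸m]≡n)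
open import Data.Product.Base using (_×_; _,_; proj₁; proj₂; ∃-syntax)
open import Data.Sum.Base as Sum using (_⊎_; inj₁; inj₂; [_,_]′)
open import Function.Base using (_∘_; id)
open import Function.Bundles using (_⇔_; mk⇔)
open import Induction.WellFounded using (Acc; acc)
open import Relation.Binary.PropositionalEquality
open import Relation.Nullary using (¬_; yes; no)

opponent≢ : ∀ p → opponent p ≢ p
opponent≢ white ()
opponent≢ black ()

opponent-involutive : ∀ p → opponent (opponent p) ≡ p
opponent-involutive white = refl
opponent-involutive black = refl

-- Since `toℕ (opposite i)` is `n ∸ suc (toℕ i)`, a fixed `i` has as many indices below it as above.
opposite-fixed⇒odd : ∀ {n} {i : Fin n} → opposite i ≡ i → n ≡ 1 + toℕ i * 2
opposite-fixed⇒odd {n} {i} fixed = begin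
  n                          ≡⟨ m+[n∸m]≡n (toℕ<n i) ⟨
  suc k + (n ∸ suc k)        ≡⟨ cong (suc k +_) (opposite-prop i) ⟨
  suc k + toℕ (opposite i)   ≡⟨ cong (λ j → suc k + toℕ j) fixed ⟩
  suc (k + k)                ≡⟨ cong (λ j → suc (k + j)) (+-identityʳ k) ⟨
  suc (2 * k)                ≡⟨ cong suc (*-comm 2 k) ⟩
  1 + k * 2                  ∎
  where
  open ≡-Reasoning
  k = toℕ i

even⇒opposite≢ : ∀ {n} → 2 ∣ n → (i : Fin n) → opposite i ≢ i
even⇒opposite≢ {n} 2∣n i fixed with () ← trans (sym (n∣m⇒m%n≡0 n 2 2∣n))
  (trans (cong (_% 2) (opposite-fixed⇒odd fixed)) ([m+kn]%n≡m%n 1 (toℕ i) 2))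

-- For even `n` no index is fixed by `opposite`, and this one is merely a valid coordinate for the
-- opening rook.
middle : ∀ n → .{{NonZero n}} → Fin n
middle n = fromℕ< (m/n<m n 2 (s≤s (s≤s z≤n)))

opposite-fixed⇒middle : ∀ {n} .{{_ : NonZero n}} {i : Fin n} → opposite i ≡ i → middle n ≡ i
opposite-fixed⇒middle {n} {i} fixed = toℕ-injective (begin
  toℕ (middle n)          ≡⟨ toℕ-fromℕ< _ ⟩
  -- The summand `1 / 2` computes to `0`.
  n / 2                   ≡⟨ cong (_/ 2) (opposite-fixed⇒odd fixed) ⟩
  (1 + toℕ i * 2) / 2     ≡⟨ +-distrib-/-∣ʳ 1 (n∣m*n (toℕ i) {2}) ⟩
  toℕ i * 2 / 2           ≡⟨ m*n/n≡m (toℕ i) 2 ⟩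
  toℕ i                   ∎)
  where open ≡-Reasoning

odd⇒opposite-middle : ∀ {n} .{{_ : NonZero n}} → ¬ 2 ∣ n → opposite (middle n) ≡ middle n
odd⇒opposite-middle {n} 2∤n = toℕ-injective (begin
  toℕ (opposite (middle n))    ≡⟨ opposite-prop (middle n) ⟩
  n ∸ suc (toℕ (middle n))     ≡⟨ cong (λ j → n ∸ suc j) (toℕ-fromℕ< _) ⟩
  n ∸ suc k                    ≡⟨ cong (_∸ suc k) n≡1+k+k ⟩
  suc k + k ∸ suc k            ≡⟨ m+n∸m≡n (suc k) k ⟩
  k                            ≡⟨ toℕ-fromℕ< _ ⟨
  toℕ (middle n)               ∎)
  where
  open ≡-Reasoning
  k = n / 2

  n%2≡1 : n % 2 ≡ 1
  n%2≡1 with n % 2 in eq | m%n<n n 2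
  ... | 0 | _ = ⊥-elim (2∤n (m%n≡0⇒n∣m n 2 eq))
  ... | 1 | _ = refl
  ... | suc (suc _) | s≤s (s≤s ())

  n≡1+k+k : n ≡ suc k + k
  n≡1+k+k = begin
    n              ≡⟨ m≡m%n+[m/n]*n n 2 ⟩
    n % 2 + k * 2  ≡⟨ cong₂ _+_ n%2≡1 (*-comm k 2) ⟩
    suc (2 * k)    ≡⟨ cong (λ j → suc (k + j)) (+-identityʳ k) ⟩
    suc k + k      ∎

module _ {n m : ℕ} where

  private variable
    p q : Player
    s t : Square n m
    pos : Position n m

  -- Playing the two strategies against each other descends through both, so it must end, yet
  -- neither side ever gets stuck. The players are related by an equation because their roles swap
  -- after every move.
  not-both-win : p ≡ opponent q → WinsToMove p pos → WinsToWait q pos → ⊥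
  not-both-win {q = q} refl (play s legal wait) (respond reply) =
    not-both-win (sym (opponent-involutive q)) (reply s legal) wait

  SameLine : Square n m → Square n m → Set
  SameLine s t = proj₁ s ≡ proj₁ t ⊎ proj₂ s ≡ proj₂ t

  Occupied : Position n m → Square n m → Set
  Occupied pos s = ∃[ q ] (q , s) ∈ pos

  -- The distinctness demanded by `InRange` comes for free, as a legal square is unoccupied.
  legal⇒¬SameLine : Legal (opponent p) s pos → (p , t) ∈ pos → ¬ SameLine t s
  legal⇒¬SameLine {p} {s} {pos} {t} legal pt∈pos line =
    Legal.unattacked legal t (subst (λ r → (r , t) ∈ pos) (sym (opponent-involutive p)) pt∈pos)
      ((λ { refl → Legal.unoccupied legal p pt∈pos }) , line)

  legal-before : ∀ {r} → Legal p s (r ∷ pos) → Legal p s pos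
  legal-before legal = record
    { unoccupied = λ q → Legal.unoccupied legal q ∘ there
    ; unattacked = λ t → Legal.unattacked legal t ∘ there
    }

  rotate : Square n m → Square n m
  rotate (x , y) = opposite x , opposite y

  rotate-involutive : ∀ s → rotate (rotate s) ≡ s
  rotate-involutive (x , y) = cong₂ _,_ (opposite-involutive x) (opposite-involutive y)

  sameLine-rotateˡ : SameLine t (rotate s) → SameLine (rotate t) s
  sameLine-rotateˡ {s = s} = Sum.map
    (λ eq → trans (cong opposite eq) (opposite-involutive (proj₁ s)))
    (λ eq → trans (cong opposite eq) (opposite-involutive (proj₂ s)))

  -- The squares of p need not all have occupied images: White's opening rook
  -- may share only a column or only a row with its image.
  record Balanced (p : Player) (pos : Position n m) : Set where
    field
      answered : (opponent p , t) ∈ pos → (p , rotate t) ∈ pos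
      paired   : (q , t) ∈ pos → SameLine t (rotate t) ⊎ Occupied pos (rotate t)
      off-axes : Legal (opponent p) s pos → ¬ SameLine (rotate s) s

  open Balanced

  -- A rook already on `rotate s` would, by `paired`, either share a line with its image `s`,
  -- against `off-axes`, or make `s` occupied. An opposing rook at `t` attacking `rotate s` was
  -- answered at `rotate t`, which would attack `s`.
  rotate-legal : Balanced p pos → Legal (opponent p) s pos →
                 Legal p (rotate s) ((opponent p , s) ∷ pos)
  rotate-legal {p} {pos} {s} bal legal = record
    { unoccupied = λ where
        q (here eq) → off-axes bal legal (inj₁ (cong (proj₁ ∘ proj₂) eq))
        q (there rs∈pos) →
          [ off-axes bal legal ∘ subst (SameLine (rotate s)) (rotate-involutive s)
          , (λ (r , occ) → Legal.unoccupied legal r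
               (subst (λ u → (r , u) ∈ pos) (rotate-involutive s) occ))
          ]′ (paired bal rs∈pos)
    ; unattacked = λ where
        t (here refl) (_ , line) → off-axes bal legal (sameLine-rotateˡ line)
        t (there t∈pos) (_ , line) →
          legal⇒¬SameLine legal (answered bal t∈pos) (sameLine-rotateˡ line)
    }

  rotate-balanced : Balanced p pos → Legal (opponent p) s pos →
                    Balanced p ((p , rotate s) ∷ (opponent p , s) ∷ pos)
  rotate-balanced {p} {pos} {s} bal legal = record
    { answered = λ where
        (here eq) → ⊥-elim (opponent≢ p (cong proj₁ eq))
        (there (here refl)) → here refl
        (there (there t∈pos)) → there (there (answered bal t∈pos))
    ; paired = λ where
        (here refl) → inj₂ (_ , there (here (cong (opponent p ,_) (rotate-involutive s))))
        (there (here refl)) → inj₂ (_ , here refl)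
        (there (there t∈pos)) → Sum.map₂ (λ (r , occ) → r , there (there occ)) (paired bal t∈pos)
    -- Further rooks only shrink the set of legal squares.
    ; off-axes = off-axes bal ∘ legal-before ∘ legal-before
    }

  index : Square n m → Fin (n * m)
  index (x , y) = combine x y

  index-injective : index s ≡ index t → s ≡ t
  index-injective {x , y} {x′ , y′} eq with refl , refl ← combine-injective x y x′ y′ eq = refl

  -- The set `free` bounds the vacant squares from above and serves as the termination measure.
  -- Discarding the opponent's square alone makes it strictly smaller in each round, so the replies
  -- may stay in it.
  Covers : Subset (n * m) → Position n m → Set
  Covers free pos = ∀ s → index s ∈ˢ free ⊎ Occupied pos s

  covers-remove : ∀ {free} r → Covers free pos → Covers (free - index s) (r ∷ (q , s) ∷ pos)
  covers-remove {s = s} r cov t with index t Fin.≟ index s | cov t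
  ... | yes eq | _ = inj₂ (_ , there (here (cong (_ ,_) (index-injective eq))))
  ... | no neq | inj₁ t∈free = inj₁ (x∈p∧x≢y⇒x∈p-y t∈free neq)
  ... | no neq | inj₂ (r′ , occ) = inj₂ (r′ , there (there occ))

  balanced⇒wins : ∀ {free} → Acc _⊂_ free → Covers free pos → Balanced p pos → WinsToWait p pos
  balanced⇒wins {pos} {p} {free} (acc rec) cov bal = respond λ s legal →
    let s∈free = [ id , (λ (r , occ) → ⊥-elim (Legal.unoccupied legal r occ)) ]′ (cov s) in
    play (rotate s) (rotate-legal bal legal)
      (balanced⇒wins (rec (x∈p⇒p-x⊂p s∈free)) (covers-remove _ cov) (rotate-balanced bal legal))

  balanced-wins : Balanced p pos → WinsToWait p pos
  balanced-wins = balanced⇒wins (⊂-wellFounded ⊤) (λ _ → inj₁ ∈⊤)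

  even⇒second-wins : 2 ∣ n → 2 ∣ m → SecondPlayerWins n m
  even⇒second-wins 2∣n 2∣m = balanced-wins record
    { answered = λ ()
    ; paired   = λ ()
    ; off-axes = λ _ → [ even⇒opposite≢ 2∣n _ , even⇒opposite≢ 2∣m _ ]′
    }

  odd⇒first-wins : .{{_ : NonZero n}} .{{_ : NonZero m}} →
                   ¬ 2 ∣ n ⊎ ¬ 2 ∣ m → WinsToMove {n} {m} white []
  odd⇒first-wins odd = play (middle n , middle m)
    (record { unoccupied = λ _ () ; unattacked = λ _ () })
    (balanced-wins record
      { answered = λ { (here ()) ; (there ()) }
      ; paired   = λ where
          -- One odd dimension suffices: the opening rook then shares that middle line with its
          -- image.
          (here refl) → inj₁ (Sum.map (sym ∘ odd⇒opposite-middle) (sym ∘ odd⇒opposite-middle) odd)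
          (there ())
      -- A square sharing a line with its image lies on a middle line, and every such line passes
      -- through the opening rook.
      ; off-axes = λ legal → legal⇒¬SameLine legal (here refl)
                     ∘ Sum.map opposite-fixed⇒middle opposite-fixed⇒middle
      })

theorem5p4 : (n m : ℕ) .{{_ : NonZero n}} .{{_ : NonZero m}} →
    SecondPlayerWins n m ⇔ (2 ∣ n × 2 ∣ m)
theorem5p4 n m = mk⇔ second-wins⇒even (λ (2∣n , 2∣m) → even⇒second-wins 2∣n 2∣m)
  where
  second-wins⇒even : SecondPlayerWins n m → 2 ∣ n × 2 ∣ m
  second-wins⇒even wins with 2 ∣? n | 2 ∣? m
  ... | yes 2∣n | yes 2∣m = 2∣n , 2∣m
  ... | no 2∤n  | _       = ⊥-elim (not-both-win refl (odd⇒first-wins (inj₁ 2∤n)) wins)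
  ... | yes _   | no 2∤m  = ⊥-elim (not-both-win refl (odd⇒first-wins (inj₂ 2∤m)) wins)
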